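{- Let $n\ge 1$ and let $F_n = K_1\vee P_n$ be the fan graph. The number of switching classes of signatures of $F_n$ that maximise the frustration index (i.e. with $l(F_n,\sigma)=l_{\max}(F_n)$) is $2^{\frac{n}{2}-1}$ when $n$ is even, and $\frac{n+3}{2}\times 2^{\frac{n-3}{2}}$ when $n$ is odd.
   Context: All graphs are finite, simple and undirected. A signed graph $\Sigma=(G,\sigma)$ is a graph $G$ with a signature $\sigma:E(G)\to\{+1,-1\}$. The sign of a cycle is the product of the signs of its edges; $\Sigma$ is balanced if all its cycles are positive. The frustration index $l(\Sigma)$ is the minimum number of edges whose deletion makes $\Sigma$ balanced; it is invariant under switching. $l_{\max}(G)=\max_\sigma l(G,\sigma)$. Switching $\Sigma$ at a vertex subset $X$ negates the signs of all edges with exactly one endpoint in $X$; two signatures of $G$ are switching equivalent if one is obtained from the other by switching, and a switching class is an equivalence class of signatures of the (labelled) graph $G$ under this relation. $P_n$ is the path on $n$ vertices and $\vee$ denotes the join of vertex-disjoint graphs. -}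

module Defs where

open import Data.Bool using (Bool; true; false; not; T; _∧_; _∨_; _xor_; if_then_else_)
open import Data.Bool.Properties using (T-∧; ∨-comm; xor-comm; xor-same; xor-assoc)
open import Data.Fin using (Fin; toℕ; splitAt; _≟_)
open import Data.Fin.Subset using (Subset)
open import Data.List using (List; []; _∷_; length; filterᵇ; cartesianProduct; allFin)
open import Data.List.Relation.Unary.Unique.Propositional using (Unique)
open import Data.Nat using (ℕ; zero; suc; _+_; _≤_; _≡ᵇ_; _<ᵇ_)
open import Data.Product using (Σ; ∃-syntax; _×_; _,_; proj₁; proj₂)
open import Data.Sign using (Sign; opposite) renaming (_*_ to _·_; + to pos; - to neg)
open import Data.Sum using (_⊎_; inj₁; inj₂)
open import Data.Vec using (lookup; replicate; zipWith)
open import Data.Vec.Properties using (lookup-replicate; lookup-zipWith)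
open import Function.Bundles using (Bijection; Equivalence)
open import Level using (0ℓ; _⊔_)
open import Relation.Binary.Bundles using (Setoid)
import Relation.Binary.Construct.On as On
open import Relation.Binary.PropositionalEquality
  using (_≡_; refl; sym; trans; cong; cong₂; setoid)
open import Relation.Nullary using (yes; no; contradiction)
open import Relation.Nullary.Decidable using (⌊_⌋)

------------------------------------------------------------------------
-- Finite simple graphs

record Graph (n : ℕ) : Set where
  field
    adj        : Fin n → Fin n → Bool
    adj-sym    : ∀ u v → adj u v ≡ adj v u
    adj-irrefl : ∀ v → adj v v ≡ false

open Graph public

module _ {n : ℕ} where

  infix 4 _⊢_~_ _⊆ᴳ_

  _⊢_~_ : Graph n → Fin n → Fin n → Set
  G ⊢ u ~ v = T (adj G u v)

  _⊆ᴳ_ : Graph n → Graph n → Set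
  H ⊆ᴳ G = ∀ {u v} → H ⊢ u ~ v → G ⊢ u ~ v

  -- Each edge is listed once, with its smaller endpoint first.
  edges : Graph n → List (Fin n × Fin n)
  edges G = filterᵇ (λ (u , v) → (toℕ u <ᵇ toℕ v) ∧ adj G u v)
                    (cartesianProduct (allFin n) (allFin n))

  edgeCount : Graph n → ℕ
  edgeCount G = length (edges G)

  -- Edge deletion.  The set of deleted edges is given as a graph D on the
  -- same vertices.
  _∖_ : Graph n → Graph n → Graph n
  (G ∖ D) .adj u v = adj G u v ∧ not (adj D u v)
  (G ∖ D) .adj-sym u v = cong₂ (λ a b → a ∧ not b) (adj-sym G u v) (adj-sym D u v)
  (G ∖ D) .adj-irrefl v = cong (_∧ not (adj D v v)) (adj-irrefl G v)

  ∖-⊆ : (G D : Graph n) → (G ∖ D) ⊆ᴳ G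
  ∖-⊆ G D p = proj₁ (Equivalence.to T-∧ p)

complete : (n : ℕ) → Graph n
complete n .adj u v = not ⌊ u ≟ v ⌋
complete n .adj-sym u v with u ≟ v | v ≟ u
... | yes _  | yes _  = refl
... | no _   | no _   = refl
... | yes eq | no ne  = contradiction (sym eq) ne
... | no ne  | yes eq = contradiction (sym eq) ne
complete n .adj-irrefl v with v ≟ v
... | yes _ = refl
... | no ne = contradiction refl ne

suc≢ᵇ : ∀ k → (suc k ≡ᵇ k) ≡ false
suc≢ᵇ zero    = refl
suc≢ᵇ (suc k) = suc≢ᵇ k

path : (n : ℕ) → Graph n
path n .adj u v = (suc (toℕ u) ≡ᵇ toℕ v) ∨ (suc (toℕ v) ≡ᵇ toℕ u)
path n .adj-sym u v = ∨-comm (suc (toℕ u) ≡ᵇ toℕ v) (suc (toℕ v) ≡ᵇ toℕ u)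
path n .adj-irrefl v = cong₂ _∨_ (suc≢ᵇ (toℕ v)) (suc≢ᵇ (toℕ v))

module _ {m n : ℕ} where

  joinAdj : Graph m → Graph n → Fin m ⊎ Fin n → Fin m ⊎ Fin n → Bool
  joinAdj G H (inj₁ u) (inj₁ v) = adj G u v
  joinAdj G H (inj₂ u) (inj₂ v) = adj H u v
  joinAdj G H (inj₁ _) (inj₂ _) = true
  joinAdj G H (inj₂ _) (inj₁ _) = true

  joinAdj-sym : ∀ G H x y → joinAdj G H x y ≡ joinAdj G H y x
  joinAdj-sym G H (inj₁ u) (inj₁ v) = adj-sym G u v
  joinAdj-sym G H (inj₂ u) (inj₂ v) = adj-sym H u v
  joinAdj-sym G H (inj₁ _) (inj₂ _) = refl
  joinAdj-sym G H (inj₂ _) (inj₁ _) = refl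

  joinAdj-irrefl : ∀ G H x → joinAdj G H x x ≡ false
  joinAdj-irrefl G H (inj₁ u) = adj-irrefl G u
  joinAdj-irrefl G H (inj₂ u) = adj-irrefl H u

  infixr 5 _∨ᴳ_

  _∨ᴳ_ : Graph m → Graph n → Graph (m + n)
  (G ∨ᴳ H) .adj u v = joinAdj G H (splitAt m u) (splitAt m v)
  (G ∨ᴳ H) .adj-sym u v = joinAdj-sym G H (splitAt m u) (splitAt m v)
  (G ∨ᴳ H) .adj-irrefl v = joinAdj-irrefl G H (splitAt m v)

fan : (n : ℕ) → Graph (1 + n)
fan n = complete 1 ∨ᴳ path n

------------------------------------------------------------------------
-- Signed graphs

-- Besides symmetry, sgn-sym also makes sgn independent of the adjacency proof.
record Signature {n : ℕ} (G : Graph n) : Set where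
  field
    sgn     : ∀ {u v} → G ⊢ u ~ v → Sign
    sgn-sym : ∀ {u v} (p : G ⊢ u ~ v) (q : G ⊢ v ~ u) → sgn p ≡ sgn q

open Signature public

module _ {n : ℕ} where

  infixr 5 _∷_

  data Walk (G : Graph n) : Fin n → Fin n → Set where
    []  : ∀ {u} → Walk G u u
    _∷_ : ∀ {u v w} → G ⊢ u ~ v → Walk G v w → Walk G u w

  vertices : ∀ {G : Graph n} {u v} → Walk G u v → List (Fin n)
  vertices {u = u} []      = u ∷ []
  vertices {u = u} (_ ∷ w) = u ∷ vertices w

  record Cycle (G : Graph n) : Set where
    field
      {start end} : Fin n
      walk        : Walk G start end
      closing     : G ⊢ end ~ start
      distinct    : Unique (vertices walk)
      long        : 3 ≤ length (vertices walk)

  module _ {G : Graph n} (σ : Signature G) where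

    walkSign : ∀ {u v} → Walk G u v → Sign
    walkSign []      = pos
    walkSign (p ∷ w) = sgn σ p · walkSign w

    cycleSign : Cycle G → Sign
    cycleSign c = sgn σ closing · walkSign walk
      where open Cycle c

    Balanced : Set
    Balanced = ∀ c → cycleSign c ≡ pos

------------------------------------------------------------------------
-- Frustration index

IsMinimum IsMaximum : (ℕ → Set) → ℕ → Set
IsMinimum P k = P k × (∀ m → P m → k ≤ m)
IsMaximum P k = P k × (∀ m → P m → m ≤ k)

module _ {n : ℕ} {G : Graph n} where

  restrict : Signature G → (D : Graph n) → Signature (G ∖ D)
  restrict σ D .sgn p = sgn σ (∖-⊆ G D p)
  restrict σ D .sgn-sym p q = sgn-sym σ (∖-⊆ G D p) (∖-⊆ G D q)

  BalancedByDeleting : Signature G → ℕ → Set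
  BalancedByDeleting σ k =
    ∃[ D ] D ⊆ᴳ G × edgeCount D ≡ k × Balanced (restrict σ D)

  -- IsFrustrationIndex σ k means l(G,σ) = k.
  IsFrustrationIndex : Signature G → ℕ → Set
  IsFrustrationIndex σ = IsMinimum (BalancedByDeleting σ)

-- IsMaxFrustrationIndex G k means l_max(G) = k.
IsMaxFrustrationIndex : ∀ {n} → Graph n → ℕ → Set
IsMaxFrustrationIndex G =
  IsMaximum (λ k → Σ (Signature G) λ σ → IsFrustrationIndex σ k)

MaximisesFrustration : ∀ {n} {G : Graph n} → Signature G → Set
MaximisesFrustration {G = G} σ =
  ∃[ k ] IsFrustrationIndex σ k × IsMaxFrustrationIndex G k

------------------------------------------------------------------------
-- Switching

negateIf : Bool → Sign → Sign
negateIf b s = if b then opposite s else s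

negateIf-∘ : ∀ a b s → negateIf a (negateIf b s) ≡ negateIf (a xor b) s
negateIf-∘ true  true  pos = refl
negateIf-∘ true  true  neg = refl
negateIf-∘ true  false s   = refl
negateIf-∘ false b     s   = refl

module _ {n : ℕ} where

  crosses : Subset n → Fin n → Fin n → Bool
  crosses X u v = lookup X u xor lookup X v

  switch : {G : Graph n} → Subset n → Signature G → Signature G
  switch X σ .sgn {u} {v} p = negateIf (crosses X u v) (sgn σ p)
  switch X σ .sgn-sym {u} {v} p q =
    cong₂ negateIf (xor-comm (lookup X u) (lookup X v)) (sgn-sym σ p q)

  module _ {G : Graph n} where

    infix 4 _≐_ _∼_

    _≐_ : Signature G → Signature G → Set
    σ ≐ τ = ∀ {u v} (p : G ⊢ u ~ v) → sgn σ p ≡ sgn τ p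

    _∼_ : Signature G → Signature G → Set
    σ ∼ τ = ∃[ X ] switch X σ ≐ τ

    ∼-refl : ∀ {σ} → σ ∼ σ
    ∼-refl {σ} = replicate n false , λ {u} {v} p →
      cong (λ b → negateIf b (sgn σ p))
           (cong₂ _xor_ (lookup-replicate u false) (lookup-replicate v false))

    ∼-sym : ∀ {σ τ} → σ ∼ τ → τ ∼ σ
    ∼-sym {σ} (X , eq) = X , λ {u} {v} p →
      trans (cong (negateIf (crosses X u v)) (sym (eq p)))
      (trans (negateIf-∘ (crosses X u v) (crosses X u v) (sgn σ p))
             (cong (λ b → negateIf b (sgn σ p)) (xor-same (crosses X u v))))

    ∼-trans : ∀ {ρ σ τ} → ρ ∼ σ → σ ∼ τ → ρ ∼ τ
    ∼-trans {ρ} (X , eq₁) (Y , eq₂) = zipWith _xor_ Y X , λ {u} {v} p →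
      trans (cong (λ b → negateIf b (sgn ρ p))
              (trans (cong₂ _xor_ (lookup-zipWith _xor_ u Y X) (lookup-zipWith _xor_ v Y X))
                     (interchange (lookup Y u) (lookup X u) (lookup Y v) (lookup X v))))
      (trans (sym (negateIf-∘ (crosses Y u v) (crosses X u v) (sgn ρ p)))
      (trans (cong (negateIf (crosses Y u v)) (eq₁ p)) (eq₂ p)))
      where
      interchange : ∀ a b c d → (a xor b) xor (c xor d) ≡ (a xor c) xor (b xor d)
      interchange a b c d =
        trans (xor-assoc a b (c xor d))
        (trans (cong (a xor_) (trans (sym (xor-assoc b c d))
               (trans (cong (_xor d) (xor-comm b c)) (xor-assoc c b d))))
               (sym (xor-assoc a c (b xor d))))

-- The elements of these setoids, up to the setoid equality, are switching
-- classes.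

switchingClasses : ∀ {n} → Graph n → Setoid 0ℓ 0ℓ
switchingClasses G = record
  { Carrier       = Signature G
  ; _≈_           = _∼_
  ; isEquivalence = record
    { refl  = λ {σ} → ∼-refl {σ = σ}
    ; sym   = λ {σ} {τ} → ∼-sym {σ = σ} {τ}
    ; trans = λ {ρ} {σ} {τ} → ∼-trans {ρ = ρ} {σ} {τ}
    }
  }

maximisingSwitchingClasses : ∀ {n} → Graph n → Setoid 0ℓ 0ℓ
maximisingSwitchingClasses G =
  On.setoid {B = Σ (Signature G) MaximisesFrustration} (switchingClasses G) proj₁

HasCardinality : ∀ {a ℓ} → Setoid a ℓ → ℕ → Set (a ⊔ ℓ)
HasCardinality S N = Bijection S (setoid (Fin N))

{-# OPTIONS --safe #-}

-- Normalising by switching, a switching class of F_n is the vector of signs of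
-- its n − 1 triangles, taken along the path.  Scanning this vector greedily --
-- take a negative triangle and skip the next one -- yields edge-disjoint negative
-- triangles, so the number taken bounds the frustration index from below; it is
-- attained, since deleting one edge of each taken triangle suffices: the spoke
-- shared with the skipped triangle if that one is negative, and the rim edge
-- otherwise.  The greedy number is at most ⌈(n − 1)/2⌉,
-- and the vectors attaining this value are counted by a two-step recursion.
module Submission where

open import Data.Bool using (Bool; true; false; not; T; _∧_; _∨_; _xor_; if_then_else_)
open import Data.Bool.Properties
  using (T-∧; T-∨; T-≡; T-not-≡; T-irrelevant; xor-comm; xor-same; xor-identityʳ; ¬-not)
open import Data.Bool.Solver using (module xor-∧-Solver)
open xor-∧-Solver using (_:+_; _:=_)
private module xor = xor-∧-Solver
open import Data.Empty using (⊥; ⊥-elim)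
open import Data.Fin using (Fin; zero; suc; toℕ; inject₁; _↑ˡ_; _↑ʳ_; splitAt)
open import Data.Fin.Properties
  using (suc-injective; toℕ-injective; toℕ-inject₁; splitAt-↑ˡ; splitAt-↑ʳ; splitAt⁻¹-↑ˡ; splitAt⁻¹-↑ʳ)
open import Data.List using ([]; _∷_; _++_; length; map; filterᵇ; cartesianProduct; tabulate)
open import Data.List.Properties using (length-++; filter-++; map-tabulate)
open import Data.List.Relation.Unary.All using ([]; _∷_)
open import Data.List.Relation.Unary.AllPairs using ([]; _∷_)
open import Data.Nat
  using (ℕ; zero; suc; _+_; _*_; _∸_; _^_; pred; _≤_; _<_; _≥_; z≤n; s≤s; _≡ᵇ_; _<ᵇ_; ⌈_/2⌉)
open import Data.Nat.DivMod using (_/_; _%_; m*n/n≡m; m*n%n≡0; [m+kn]%n≡m%n)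
open import Data.Nat.Properties
  using ( ≤-refl; ≤-trans; ≤-antisym; ≤-reflexive; n≤1+n; m≤n+m; +-mono-≤
        ; +-identityʳ; +-suc; ⌈n/2⌉-mono
        ; +-0-commutativeMonoid; ≡ᵇ⇒≡; ≡⇒≡ᵇ; <⇒<ᵇ; <ᵇ⇒<; <-asym; 1+n≢n; module ≤-Reasoning)
open import Data.Nat.Tactic.RingSolver using (solve-∀)
open import Data.Product using (Σ; ∃-syntax; _×_; _,_; proj₁; proj₂)
open import Data.Sign using (Sign) renaming (_*_ to _·_; + to pos; - to neg)
open import Data.Sum using (inj₁; inj₂)
open import Data.Unit using (tt)
open import Data.Vec as Vec using (Vec; []; _∷_; lookup; replicate)
open import Data.Vec.Properties using (lookup∘tabulate; tabulate∘lookup; tabulate-cong)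
open import Function.Base using (_∘_)
open import Function.Bundles using (Equivalence)
open import Relation.Binary.PropositionalEquality
  using (_≡_; refl; sym; trans; cong; cong₂; subst; module ≡-Reasoning)
open import Relation.Nullary using (T?; ¬_; contradiction)
open import Algebra.Properties.CommutativeMonoid.Sum +-0-commutativeMonoid
  using (sum; sum-cong-≗; sum-replicate-zero)
open import Defs

variable
  m n : ℕ

-- Greedy packing of negative triangles.

-- `true` stands for a negative triangle. Consecutive triangles share a spoke, which is why the
-- entry after a taken one is discarded whatever its value.
packing : Vec Bool n → ℕ
packing []                = 0
packing (false ∷ t)       = packing t
packing (true ∷ [])       = 1
packing (true ∷ _ ∷ t)    = suc (packing t)

packing-≤ : (t : Vec Bool n) → packing t ≤ ⌈ n /2⌉
packing-≤ []                 = z≤n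
packing-≤ {suc n} (false ∷ t) = ≤-trans (packing-≤ t) (⌈n/2⌉-mono (n≤1+n n))
packing-≤ (true ∷ [])        = ≤-refl
packing-≤ (true ∷ _ ∷ t)     = s≤s (packing-≤ t)

packing-replicate : ∀ n → packing (replicate n true) ≡ ⌈ n /2⌉
packing-replicate zero          = refl
packing-replicate (suc zero)    = refl
packing-replicate (suc (suc n)) = cong suc (packing-replicate n)

-- Enumeration of the Boolean vectors satisfying a predicate.

-- Branching on the first entry makes counts over `packing` unfold by computation, and `index`
-- places the `true` block before the `false` block accordingly.
count : (Vec Bool n → Bool) → ℕ
count {zero}  p = if p [] then 1 else 0
count {suc n} p = count (p ∘ (true ∷_)) + count (p ∘ (false ∷_))

index₀ : ∀ b → T b → Fin (if b then 1 else 0)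
index₀ true _ = zero

index₀-surjective : ∀ b i → Σ (T b) λ pt → index₀ b pt ≡ i
index₀-surjective true zero = tt , refl

index : (p : Vec Bool n → Bool) (t : Vec Bool n) → T (p t) → Fin (count p)
index {zero} p [] pt = index₀ (p []) pt
index {suc n} p (true ∷ t)  pt = index (p ∘ (true ∷_)) t pt ↑ˡ count (p ∘ (false ∷_))
index {suc n} p (false ∷ t) pt = count (p ∘ (true ∷_)) ↑ʳ index (p ∘ (false ∷_)) t pt

unindex : (p : Vec Bool n → Bool) → Fin (count p) → Vec Bool n
unindex {zero}  p i = []
unindex {suc n} p i with splitAt (count (p ∘ (true ∷_))) i
... | inj₁ j = true  ∷ unindex (p ∘ (true ∷_)) j
... | inj₂ j = false ∷ unindex (p ∘ (false ∷_)) j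

unindex-index : ∀ (p : Vec Bool n → Bool) t pt → unindex p (index p t pt) ≡ t
unindex-index {zero} p [] pt = refl
unindex-index {suc n} p (true ∷ t) pt
  rewrite splitAt-↑ˡ _ (index (p ∘ (true ∷_)) t pt) (count (p ∘ (false ∷_)))
  = cong (true ∷_) (unindex-index (p ∘ (true ∷_)) t pt)
unindex-index {suc n} p (false ∷ t) pt
  rewrite splitAt-↑ʳ (count (p ∘ (true ∷_))) _ (index (p ∘ (false ∷_)) t pt)
  = cong (false ∷_) (unindex-index (p ∘ (false ∷_)) t pt)

index-surjective : ∀ (p : Vec Bool n → Bool) i → ∃[ t ] Σ (T (p t)) λ pt → index p t pt ≡ i
index-surjective {zero} p i = [] , index₀-surjective (p []) i
index-surjective {suc n} p i with splitAt (count (p ∘ (true ∷_))) i in eq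
... | inj₁ j = let t , pt , e = index-surjective (p ∘ (true ∷_)) j in
  true ∷ t , pt , trans (cong (_↑ˡ _) e) (splitAt⁻¹-↑ˡ eq)
... | inj₂ j = let t , pt , e = index-surjective (p ∘ (false ∷_)) j in
  false ∷ t , pt , trans (cong (_ ↑ʳ_) e) (splitAt⁻¹-↑ʳ eq)

-- Counting the vectors with maximal packing.

-- `withPacking (2 + m) (1 + k)` computes to two copies of `withPacking m k` plus
-- `withPacking (1 + m) (1 + k)`: a leading `true` leaves the skipped entry free, a leading `false`
-- is dropped.
withPacking : ℕ → ℕ → ℕ
withPacking m k = count {m} λ t → packing t ≡ᵇ k

-- The bound `packing-≤` in counting form, obtained directly from the recursion: all three summands
-- lie above their own bound.
withPacking-zero : ∀ m k → ⌈ m /2⌉ < k → withPacking m k ≡ 0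
withPacking-zero zero          (suc k)       lt = refl
withPacking-zero (suc zero)    (suc zero)    (s≤s ())
withPacking-zero (suc zero)    (suc (suc k)) lt = refl
withPacking-zero (suc (suc m)) (suc k) lt@(s≤s lt′)
  = cong₂ _+_ (cong₂ _+_ ih ih)
      (withPacking-zero (suc m) (suc k) (≤-trans (s≤s (⌈n/2⌉-mono (n≤1+n (suc m)))) lt))
  where ih = withPacking-zero m k lt′

⌈j*2/2⌉ : ∀ j → ⌈ j * 2 /2⌉ ≡ j
⌈j*2/2⌉ zero    = refl
⌈j*2/2⌉ (suc j) = cong suc (⌈j*2/2⌉ j)

⌈1+j*2/2⌉ : ∀ j → ⌈ suc (j * 2) /2⌉ ≡ suc j
⌈1+j*2/2⌉ zero    = refl
⌈1+j*2/2⌉ (suc j) = cong suc (⌈1+j*2/2⌉ j)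

-- A leading `false` leaves an even length, whose bound is one too small, so this branch vanishes
-- and each step merely doubles the count.
withPacking-odd : ∀ j → withPacking (suc (j * 2)) (suc j) ≡ 2 ^ j
withPacking-odd zero    = refl
withPacking-odd (suc j)
  rewrite withPacking-odd j
        | withPacking-zero (suc j * 2) (suc (suc j)) (s≤s (≤-reflexive (⌈j*2/2⌉ (suc j))))
        = lemma (2 ^ j)
  where
  lemma : ∀ a → a + a + 0 ≡ 2 * a
  lemma = solve-∀

-- Here a leading `false` contributes the odd count `2 ^ j`, so the recursion is
-- `a ↦ 2 * a + 2 ^ j`. The factor 2 on the left avoids the exponent `j - 1` at `j = 0`.
withPacking-even : ∀ j → 2 * withPacking (j * 2) j ≡ (2 + j) * 2 ^ j
withPacking-even zero    = refl
withPacking-even (suc j) rewrite withPacking-odd j =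
  lemma (withPacking (j * 2) j) (2 ^ j) j (withPacking-even j)
  where
  lemma : ∀ a b j → 2 * a ≡ (2 + j) * b → 2 * (a + a + b) ≡ (3 + j) * (2 * b)
  lemma a b j eq = begin
    2 * (a + a + b)           ≡⟨ l₁ a b ⟩
    2 * (2 * a + b)           ≡⟨ cong (λ x → 2 * (x + b)) eq ⟩
    2 * ((2 + j) * b + b)     ≡⟨ l₂ b j ⟩
    (3 + j) * (2 * b)         ∎
    where
    open ≡-Reasoning
    l₁ : ∀ a b → 2 * (a + a + b) ≡ 2 * (2 * a + b)
    l₁ = solve-∀
    l₂ : ∀ b j → 2 * ((2 + j) * b + b) ≡ (3 + j) * (2 * b)
    l₂ = solve-∀

-- Cutting triangles: lower bound and optimal cuts.

𝟙 : Bool → ℕ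
𝟙 b = if b then 1 else 0

total : (Fin n → Bool) → ℕ
total b = sum (𝟙 ∘ b)

𝟙-∨ : ∀ a b c → T (a ∨ b ∨ c) → 1 ≤ 𝟙 a + 𝟙 b + 𝟙 c
𝟙-∨ true  b     c    _ = s≤s z≤n
𝟙-∨ false true  c    _ = s≤s z≤n
𝟙-∨ false false true _ = s≤s z≤n

-- `s` and `e` mark the deleted spokes and rim edges. Each taken triangle is charged to a deleted
-- edge of its own. The skip moves past its second spoke, so no edge is charged twice; after a
-- `false` only the first spoke and the rim edge are left behind.
packing-lower : (t : Vec Bool m) (s : Fin (suc m) → Bool) (e : Fin m → Bool) →
  (∀ i → lookup t i ≡ true → T (s (inject₁ i) ∨ e i ∨ s (suc i))) →
  packing t ≤ total s + total e
packing-lower [] s e hit = z≤n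
packing-lower (false ∷ t) s e hit =
  ≤-trans (packing-lower t (s ∘ suc) (e ∘ suc) (hit ∘ suc))
          (+-mono-≤ (m≤n+m _ (𝟙 (s zero))) (m≤n+m _ (𝟙 (e zero))))
packing-lower (true ∷ []) s e hit =
  ≤-trans (𝟙-∨ (s zero) (e zero) (s (suc zero)) (hit zero refl))
          (≤-reflexive (rearrange (𝟙 (s zero)) (𝟙 (e zero)) (𝟙 (s (suc zero)))))
  where
  rearrange : ∀ a c b → a + c + b ≡ (a + (b + 0)) + (c + 0)
  rearrange = solve-∀
packing-lower (true ∷ _ ∷ t) s e hit = begin
  1 + packing t
    ≤⟨ +-mono-≤ (≤-trans (𝟙-∨ (s zero) (e zero) (s (suc zero)) (hit zero refl)) (m≤n+m _ (𝟙 (e (suc zero)))))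
                (packing-lower t s″ e″ (λ i → hit (suc (suc i)))) ⟩
  _ ≡⟨ rearrange (𝟙 (s zero)) (𝟙 (e zero)) (𝟙 (s (suc zero))) (𝟙 (e (suc zero))) (total s″) (total e″) ⟩
  total s + total e ∎
  where
  open ≤-Reasoning
  s″ = λ i → s (suc (suc i))
  e″ = λ i → e (suc (suc i))
  rearrange : ∀ a c b d S E → (d + (a + c + b)) + (S + E) ≡ (a + (b + S)) + (c + (d + E))
  rearrange = solve-∀

-- In the last clause `b` is the sign of the skipped triangle: one cut on the shared spoke serves
-- both triangles if `b` holds, and `rimCuts` takes over otherwise.
spokeCuts : Vec Bool m → Vec Bool (suc m)
spokeCuts []             = false ∷ []
spokeCuts (false ∷ t)    = false ∷ spokeCuts t
spokeCuts (true ∷ [])    = false ∷ false ∷ []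
spokeCuts (true ∷ b ∷ t) = false ∷ b ∷ spokeCuts t

rimCuts : Vec Bool m → Vec Bool m
rimCuts []             = []
rimCuts (false ∷ t)    = false ∷ rimCuts t
rimCuts (true ∷ [])    = true ∷ []
rimCuts (true ∷ b ∷ t) = not b ∷ false ∷ rimCuts t

total-cuts : (t : Vec Bool m) → total (lookup (spokeCuts t)) + total (lookup (rimCuts t)) ≡ packing t
total-cuts []                 = refl
total-cuts (false ∷ t)        = total-cuts t
total-cuts (true ∷ [])        = refl
total-cuts (true ∷ true ∷ t)  = cong suc (total-cuts t)
total-cuts (true ∷ false ∷ t) = trans (+-suc _ _) (cong suc (total-cuts t))

-- The spoke where one greedy block meets the next is never cut, so the cuts of later blocks do not
-- affect earlier triangles.
spokeCuts-head : (t : Vec Bool m) → lookup (spokeCuts t) zero ≡ false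
spokeCuts-head []             = refl
spokeCuts-head (false ∷ t)    = refl
spokeCuts-head (true ∷ [])    = refl
spokeCuts-head (true ∷ b ∷ t) = refl

-- Parity is stronger than meeting every negative triangle: negating the cut edges makes all
-- triangles positive, and this yields a potential for the surviving edges.
cuts-correct : (t : Vec Bool m) → ∀ i →
  lookup t i ≡ (lookup (spokeCuts t) (inject₁ i) xor lookup (spokeCuts t) (suc i)) xor lookup (rimCuts t) i
cuts-correct (false ∷ t)        zero          rewrite spokeCuts-head t = refl
cuts-correct (false ∷ t)        (suc i)       = cuts-correct t i
cuts-correct (true ∷ [])        zero          = refl
cuts-correct (true ∷ true ∷ t)  zero          = refl
cuts-correct (true ∷ false ∷ t) zero          = refl
cuts-correct (true ∷ true ∷ t)  (suc zero)    rewrite spokeCuts-head t = refl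
cuts-correct (true ∷ false ∷ t) (suc zero)    rewrite spokeCuts-head t = refl
cuts-correct (true ∷ b ∷ t)     (suc (suc i)) = cuts-correct t i

-- Edge counts as double sums.

length-filterᵇ-tabulate : ∀ {A : Set} (P : A → Bool) (g : Fin n → A) →
  length (filterᵇ P (tabulate g)) ≡ total (P ∘ g)
length-filterᵇ-tabulate {zero}  P g = refl
length-filterᵇ-tabulate {suc n} P g with P (g zero)
... | true  = cong suc (length-filterᵇ-tabulate P (g ∘ suc))
... | false = length-filterᵇ-tabulate P (g ∘ suc)

length-filterᵇ-cartesianProduct : ∀ {A B : Set} (P : A × B → Bool) (g : Fin m → A) (h : Fin n → B) →
  length (filterᵇ P (cartesianProduct (tabulate g) (tabulate h))) ≡ sum (λ i → total (λ j → P (g i , h j)))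
length-filterᵇ-cartesianProduct {zero}  P g h = refl
length-filterᵇ-cartesianProduct {suc m} P g h = begin
  length (filterᵇ P (row ++ rest))                  ≡⟨ cong length (filter-++ (T? ∘ P) row rest) ⟩
  length (filterᵇ P row ++ filterᵇ P rest)          ≡⟨ length-++ (filterᵇ P row) ⟩
  length (filterᵇ P row) + length (filterᵇ P rest)
    ≡⟨ cong₂ _+_ (trans (cong (length ∘ filterᵇ P) (map-tabulate h (g zero ,_)))
                        (length-filterᵇ-tabulate P (λ j → g zero , h j)))
                 (length-filterᵇ-cartesianProduct P (g ∘ suc) h) ⟩
  sum (λ i → total (λ j → P (g i , h j))) ∎
  where
  open ≡-Reasoning
  row  = map (g zero ,_) (tabulate h)
  rest = cartesianProduct (tabulate (g ∘ suc)) (tabulate h)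

total-false : (b : Fin n → Bool) → (∀ i → b i ≡ false) → total b ≡ 0
total-false {n} b b≡false = trans (sum-cong-≗ (cong 𝟙 ∘ b≡false)) (sum-replicate-zero n)

-- Induction by peeling off the first row and column: the row keeps only its second entry, the
-- column nothing below the corner.
total-superdiagonal : (P : Fin (suc m) → Fin (suc m) → Bool) →
  (∀ i j → T (P i j) → suc (toℕ i) ≡ toℕ j) →
  sum (λ i → total (P i)) ≡ total (λ i → P (inject₁ i) (suc i))
total-superdiagonal {zero} P diag with P zero zero | diag zero zero
... | true  | d with () ← d tt
... | false | _ = refl
total-superdiagonal {suc m} P diag = cong₂ _+_ first rest
  where
  open ≡-Reasoning
  off : ∀ i j → ¬ suc (toℕ i) ≡ toℕ j → P i j ≡ false
  off i j ne = ¬-not (ne ∘ diag i j ∘ Equivalence.from T-≡)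
  first : total (P zero) ≡ 𝟙 (P zero (suc zero))
  first = begin
    𝟙 (P zero zero) + (𝟙 (P zero (suc zero)) + total (λ j → P zero (suc (suc j))))
      ≡⟨ cong₂ (λ x y → 𝟙 x + (𝟙 (P zero (suc zero)) + y)) (off zero zero λ ())
           (total-false _ (λ j → off zero (suc (suc j)) λ ())) ⟩
    𝟙 (P zero (suc zero)) + 0 ≡⟨ +-identityʳ _ ⟩
    𝟙 (P zero (suc zero)) ∎
  rest : sum (λ i → total (P (suc i))) ≡ total (λ i → P (inject₁ (suc i)) (suc (suc i)))
  rest = begin
    sum (λ i → 𝟙 (P (suc i) zero) + total (λ j → P (suc i) (suc j)))
      ≡⟨ sum-cong-≗ (λ i → cong (λ x → 𝟙 x + total (λ j → P (suc i) (suc j))) (off (suc i) zero λ ())) ⟩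
    sum (λ i → total (λ j → P (suc i) (suc j)))
      ≡⟨ total-superdiagonal (λ i j → P (suc i) (suc j)) (λ i j p → cong pred (diag (suc i) (suc j) p)) ⟩
    total (λ i → P (suc (inject₁ i)) (suc (suc i))) ∎

-- The edges of a fan.

rimEdge : (i : Fin m) → fan (suc m) ⊢ suc (inject₁ i) ~ suc (suc i)
rimEdge i = Equivalence.from T-∨ (inj₁ (≡⇒≡ᵇ _ _ (cong suc (toℕ-inject₁ i))))

consecutive : (i j : Fin (suc m)) → suc (toℕ i) ≡ toℕ j → ∃[ k ] i ≡ inject₁ k × j ≡ suc k
consecutive i (suc j) eq =
  j , toℕ-injective (trans (cong pred eq) (sym (toℕ-inject₁ j))) , refl

-- Case analysis on edges, with one orientation of each to be treated. `flip` receives adjacency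
-- proofs for both directions so that `sgn-sym` applies, and proof irrelevance carries `rimEdge` to
-- an arbitrary proof.
fan-elim : (P : ∀ u v → fan (suc m) ⊢ u ~ v → Set) →
  (∀ u v (p : fan (suc m) ⊢ u ~ v) (q : fan (suc m) ⊢ v ~ u) → P u v p → P v u q) →
  (∀ i → P zero (suc i) tt) → (∀ i → P (suc (inject₁ i)) (suc (suc i)) (rimEdge i)) →
  ∀ u v (p : fan (suc m) ⊢ u ~ v) → P u v p
fan-elim {m} P flip spoke rim = go
  where
  ascending : ∀ i j → suc (toℕ i) ≡ toℕ j → (p : fan (suc m) ⊢ suc i ~ suc j) → P (suc i) (suc j) p
  ascending i j eq p with k , refl , refl ← consecutive i j eq =
    subst (P _ _) (T-irrelevant (rimEdge k) p) (rim k)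
  go : ∀ u v (p : fan (suc m) ⊢ u ~ v) → P u v p
  go zero    (suc j) tt = spoke j
  go (suc i) zero    tt = flip zero (suc i) tt tt (spoke i)
  go (suc i) (suc j) p with Equivalence.to (T-∨ {suc (toℕ i) ≡ᵇ toℕ j}) p
  ... | inj₁ q = ascending i j (≡ᵇ⇒≡ _ _ q) p
  ... | inj₂ q = flip (suc j) (suc i) p′ p (ascending j i (≡ᵇ⇒≡ _ _ q) p′)
    where p′ = subst T (adj-sym (fan (suc m)) (suc i) (suc j)) p

-- The hub `zero` is the smaller endpoint of every spoke, so row zero of `P` computes to the spokes
-- and column zero to nothing. Among rim vertices the ordering test keeps one orientation, which
-- lies on the superdiagonal.
edgeCount-fan : (D : Graph (2 + m)) → D ⊆ᴳ fan (suc m) →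
  edgeCount D ≡ total (λ i → adj D zero (suc i)) + total (λ i → adj D (suc (inject₁ i)) (suc (suc i)))
edgeCount-fan {m} D D⊆fan =
  trans (length-filterᵇ-cartesianProduct P (λ i → i) (λ j → j))
        (cong (total (λ i → adj D zero (suc i)) +_)
          (trans (total-superdiagonal (λ i j → P (suc i , suc j)) superdiagonal)
                 (sum-cong-≗ λ i → cong (λ b → 𝟙 (b ∧ adj D (suc (inject₁ i)) (suc (suc i)))) (ascends i))))
  where
  P : Fin (2 + m) × Fin (2 + m) → Bool
  P (u , v) = (toℕ u <ᵇ toℕ v) ∧ adj D u v
  ascends : (i : Fin m) → (toℕ (inject₁ i) <ᵇ suc (toℕ i)) ≡ true
  ascends i = Equivalence.to T-≡ (<⇒<ᵇ (s≤s (≤-reflexive (toℕ-inject₁ i))))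
  superdiagonal : ∀ i j → T (P (suc i , suc j)) → suc (toℕ i) ≡ toℕ j
  superdiagonal i j p with Equivalence.to (T-∧ {toℕ i <ᵇ toℕ j}) p
  ... | i<j , d with Equivalence.to (T-∨ {suc (toℕ i) ≡ᵇ toℕ j}) (D⊆fan {suc i} {suc j} d)
  ... | inj₁ q = ≡ᵇ⇒≡ _ _ q
  ... | inj₂ q = ⊥-elim (<-asym (<ᵇ⇒< _ _ i<j) (≤-reflexive (≡ᵇ⇒≡ (suc (toℕ j)) (toℕ i) q)))

-- Signs as Booleans.

-- Products and switching both become `xor`, so sign identities can be left to the ring solver.
isNeg : Sign → Bool
isNeg pos = false
isNeg neg = true

toSign : Bool → Sign
toSign b = if b then neg else pos

isNeg-toSign : ∀ b → isNeg (toSign b) ≡ b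
isNeg-toSign true  = refl
isNeg-toSign false = refl

isNeg-injective : ∀ {s t} → isNeg s ≡ isNeg t → s ≡ t
isNeg-injective {pos} {pos} _ = refl
isNeg-injective {neg} {neg} _ = refl

isNeg-· : ∀ s t → isNeg (s · t) ≡ isNeg s xor isNeg t
isNeg-· pos t   = refl
isNeg-· neg pos = refl
isNeg-· neg neg = refl

isNeg-negateIf : ∀ b s → isNeg (negateIf b s) ≡ b xor isNeg s
isNeg-negateIf false s   = refl
isNeg-negateIf true  pos = refl
isNeg-negateIf true  neg = refl

negative : ∀ {G : Graph n} (σ : Signature G) u v → G ⊢ u ~ v → Bool
negative σ u v p = isNeg (sgn σ {u} {v} p)

negative-sym : ∀ {G : Graph n} (σ : Signature G) u v (p : G ⊢ u ~ v) (q : G ⊢ v ~ u) →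
  negative σ u v p ≡ negative σ v u q
negative-sym σ u v p q = cong isNeg (sgn-sym σ {u} {v} p q)

negative-irrelevant : ∀ {G : Graph n} (σ : Signature G) u v (p q : G ⊢ u ~ v) →
  negative σ u v p ≡ negative σ u v q
negative-irrelevant σ u v p q = cong (negative σ u v) (T-irrelevant p q)

-- The easy half of Harary's criterion, with `x` as switching set: the sign of a walk telescopes to
-- its two endpoints, and the closing edge cancels them.
potential⇒balanced : ∀ {G : Graph n} (σ : Signature G) (x : Fin n → Bool) →
  (∀ u v p → negative σ u v p ≡ x u xor x v) → Balanced σ
potential⇒balanced {G = G} σ x pot c = isNeg-injective (begin
  isNeg (sgn σ closing · walkSign σ walk)             ≡⟨ isNeg-· (sgn σ closing) _ ⟩
  isNeg (sgn σ closing) xor isNeg (walkSign σ walk)   ≡⟨ cong₂ _xor_ (pot end start closing) (walk-pot walk) ⟩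
  (x end xor x start) xor (x start xor x end)         ≡⟨ cong (_xor (x start xor x end)) (xor-comm (x end) (x start)) ⟩
  (x start xor x end) xor (x start xor x end)         ≡⟨ xor-same (x start xor x end) ⟩
  false                                               ∎)
  where
  open ≡-Reasoning
  open Cycle c
  telescope : ∀ a b c → (a xor b) xor (b xor c) ≡ a xor c
  telescope = xor.solve 3 (λ a b c → (a :+ b) :+ (b :+ c) := a :+ c) refl
  walk-pot : ∀ {u v} (w : Walk G u v) → isNeg (walkSign σ w) ≡ x u xor x v
  walk-pot {u} []                = sym (xor-same (x u))
  walk-pot (_∷_ {u} {v} {w} p q) =
    trans (isNeg-· (sgn σ p) _) (trans (cong₂ _xor_ (pot u v p) (walk-pot q)) (telescope (x u) (x v) (x w)))

-- Triangles of a signed fan.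

spoke : Signature (fan (suc m)) → Fin (suc m) → Bool
spoke σ i = negative σ zero (suc i) tt

rim : Signature (fan (suc m)) → Fin m → Bool
rim σ i = negative σ (suc (inject₁ i)) (suc (suc i)) (rimEdge i)

triangle : Signature (fan (suc m)) → Fin m → Bool
triangle σ i = (spoke σ (inject₁ i) xor spoke σ (suc i)) xor rim σ i

triangles : Signature (fan (suc m)) → Vec Bool m
triangles σ = Vec.tabulate (triangle σ)

∨-intro : ∀ a b c → (a ≡ false → b ≡ false → c ≡ false → ⊥) → T (a ∨ b ∨ c)
∨-intro true  b     c     f = tt
∨-intro false true  c     f = tt
∨-intro false false true  f = tt
∨-intro false false false f = f refl refl refl

-- If all three edges survived, the triangle would be a negative cycle of the balanced remainder.
negativeTriangle-hit : (σ : Signature (fan (suc m))) (D : Graph (2 + m)) → Balanced (restrict σ D) →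
  ∀ i → triangle σ i ≡ true →
  T (adj D zero (suc (inject₁ i)) ∨ adj D (suc (inject₁ i)) (suc (suc i)) ∨ adj D zero (suc (suc i)))
negativeTriangle-hit {m} σ D balanced i triangle-negative =
  ∨-intro (adj D zero (suc (inject₁ i))) _ _ λ d₁ d₂ d₃ → contradicts (kept zero a tt d₁)
    (kept a b (rimEdge i) d₂) (kept b zero tt (trans (adj-sym D b zero) d₃))
  where
  open ≡-Reasoning
  G = fan (suc m)
  a = suc (inject₁ i)
  b = suc (suc i)
  kept : ∀ u v → G ⊢ u ~ v → adj D u v ≡ false → (G ∖ D) ⊢ u ~ v
  kept u v p d = Equivalence.from T-∧ (p , Equivalence.from T-not-≡ d)
  a≢b : a ≡ b → ⊥
  a≢b eq = 1+n≢n (sym (trans (sym (toℕ-inject₁ i)) (cong toℕ (suc-injective eq))))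
  contradicts : (G ∖ D) ⊢ zero ~ a → (G ∖ D) ⊢ a ~ b → (G ∖ D) ⊢ b ~ zero → ⊥
  contradicts p q r = contradiction (trans (sym triangle-negative) (begin
    (spoke σ (inject₁ i) xor spoke σ (suc i)) xor rim σ i
      ≡⟨ cong₂ _xor_ (cong₂ _xor_ (negative-irrelevant σ zero a tt p′) (negative-sym σ zero b tt r′))
                     (negative-irrelevant σ a b (rimEdge i) q′) ⟩
    (negative σ zero a p′ xor negative σ b zero r′) xor negative σ a b q′
      -- The cycle runs hub, `a`, `b`, hub, whereas `triangle` puts the two spokes first.
      ≡⟨ rotate (sgn σ {zero} {a} p′) (sgn σ {a} {b} q′) (sgn σ {b} {zero} r′) ⟩
    isNeg (cycleSign (restrict σ D) cycle)
      ≡⟨ cong isNeg (balanced cycle) ⟩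
    false ∎)) λ ()
    where
    p′ = ∖-⊆ G D {zero} {a} p
    q′ = ∖-⊆ G D {a} {b} q
    r′ = ∖-⊆ G D {b} {zero} r
    cycle : Cycle (G ∖ D)
    cycle = record
      { walk     = _∷_ {u = zero} {v = a} p (_∷_ {u = a} {v = b} q [])
      ; closing  = r
      ; distinct = ((λ ()) ∷ (λ ()) ∷ []) ∷ (a≢b ∷ []) ∷ [] ∷ []
      ; long     = s≤s (s≤s (s≤s z≤n))
      }
    rotate : ∀ s t r → (isNeg s xor isNeg r) xor isNeg t ≡ isNeg (r · (s · (t · pos)))
    rotate pos pos pos = refl
    rotate pos pos neg = refl
    rotate pos neg pos = refl
    rotate pos neg neg = refl
    rotate neg pos pos = refl
    rotate neg pos neg = refl
    rotate neg neg pos = refl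
    rotate neg neg neg = refl

-- The frustration index of a signed fan.

packing-≤-deletion : (σ : Signature (fan (suc m))) → ∀ k → BalancedByDeleting σ k → packing (triangles σ) ≤ k
packing-≤-deletion σ k (D , D⊆fan , refl , balanced) =
  subst (packing (triangles σ) ≤_) (sym (edgeCount-fan D (λ {u} {v} → D⊆fan {u} {v})))
    (packing-lower (triangles σ) (λ i → adj D zero (suc i)) _ λ i t →
      negativeTriangle-hit σ D balanced i (trans (sym (lookup∘tabulate (triangle σ) i)) t))

-- Only the values at consecutive indices matter; the others are chosen symmetric.
alongRim : Vec Bool m → Fin (suc m) → Fin (suc m) → Bool
alongRim []      _       _       = false
alongRim (b ∷ e) zero    _       = b
alongRim (b ∷ e) (suc _) zero    = b
alongRim (b ∷ e) (suc i) (suc j) = alongRim e i j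

alongRim-sym : (e : Vec Bool m) → ∀ i j → alongRim e i j ≡ alongRim e j i
alongRim-sym []      _       _       = refl
alongRim-sym (b ∷ e) zero    zero    = refl
alongRim-sym (b ∷ e) zero    (suc _) = refl
alongRim-sym (b ∷ e) (suc _) zero    = refl
alongRim-sym (b ∷ e) (suc i) (suc j) = alongRim-sym e i j

alongRim-edge : (e : Vec Bool m) → ∀ i → alongRim e (inject₁ i) (suc i) ≡ lookup e i
alongRim-edge (b ∷ e) zero    = refl
alongRim-edge (b ∷ e) (suc i) = alongRim-edge e i

-- The deletion set as a graph: spokes from `s`, rim edges from `e`. The path adjacency masks the
-- arbitrary values of `alongRim` off the rim.
subfan : Vec Bool (suc m) → Vec Bool m → Graph (2 + m)
subfan s e .adj zero    zero    = false
subfan s e .adj zero    (suc j) = lookup s j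
subfan s e .adj (suc i) zero    = lookup s i
subfan {m} s e .adj (suc i) (suc j) = adj (path (suc m)) i j ∧ alongRim e i j
subfan s e .adj-sym zero    zero    = refl
subfan s e .adj-sym zero    (suc j) = refl
subfan s e .adj-sym (suc i) zero    = refl
subfan {m} s e .adj-sym (suc i) (suc j) = cong₂ _∧_ (adj-sym (path (suc m)) i j) (alongRim-sym e i j)
subfan s e .adj-irrefl zero    = refl
subfan {m} s e .adj-irrefl (suc i) = cong (_∧ alongRim e i i) (adj-irrefl (path (suc m)) i)

subfan-⊆ : (s : Vec Bool (suc m)) (e : Vec Bool m) → subfan s e ⊆ᴳ fan (suc m)
subfan-⊆ s e {zero}  {suc j} _ = tt
subfan-⊆ s e {suc i} {zero}  _ = tt
subfan-⊆ s e {suc i} {suc j} p = proj₁ (Equivalence.to T-∧ p)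

subfan-rim : (s : Vec Bool (suc m)) (e : Vec Bool m) → ∀ i →
  adj (subfan s e) (suc (inject₁ i)) (suc (suc i)) ≡ lookup e i
subfan-rim s e i = cong₂ _∧_ (Equivalence.to T-≡ (rimEdge i)) (alongRim-edge e i)

-- The greedy cuts have the right size by `total-cuts`; balance follows from an explicit potential
-- on the surviving edges.
packing-deletion : (σ : Signature (fan (suc m))) → BalancedByDeleting σ (packing (triangles σ))
packing-deletion {m} σ = D , (λ {u} {v} → subfan-⊆ s e {u} {v}) , size , potential⇒balanced (restrict σ D) x
  (λ u v p → unless u v (∖-⊆ G D {u} {v} p)
    (Equivalence.to T-not-≡ (proj₂ (Equivalence.to (T-∧ {adj G u v}) p))))
  where
  open ≡-Reasoning
  G = fan (suc m)
  t = triangles σ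
  s = spokeCuts t
  e = rimCuts t
  D = subfan s e
  -- With the hub at `false`, these values are forced by the spokes once the cut ones are negated.
  x : Fin (2 + m) → Bool
  x zero    = false
  x (suc i) = spoke σ i xor lookup s i
  size : edgeCount D ≡ packing t
  size = begin
    edgeCount D ≡⟨ edgeCount-fan D (λ {u} {v} → subfan-⊆ s e {u} {v}) ⟩
    total (lookup s) + total (λ i → adj D (suc (inject₁ i)) (suc (suc i)))
      ≡⟨ cong (total (lookup s) +_) (sum-cong-≗ (cong 𝟙 ∘ subfan-rim s e)) ⟩
    total (lookup s) + total (lookup e) ≡⟨ total-cuts t ⟩
    packing t ∎
  unless : ∀ u v (p : G ⊢ u ~ v) → adj D u v ≡ false → negative σ u v p ≡ x u xor x v
  unless = fan-elim (λ u v p → adj D u v ≡ false → negative σ u v p ≡ x u xor x v)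
    (λ u v p q h d → trans (negative-sym σ v u q p) (trans (h (trans (adj-sym D u v) d)) (xor-comm (x u) (x v))))
    (λ i d → sym (trans (cong (spoke σ i xor_) d) (xor-identityʳ _)))
    -- A surviving rim edge has cut value `false`, so `cuts-correct` equates the sign of its
    -- triangle with the parity of the two spoke cuts.
    (λ i d → rimCase (spoke σ (inject₁ i)) (spoke σ (suc i)) (rim σ i) (lookup s (inject₁ i)) (lookup s (suc i))
      (begin
        triangle σ i                                                      ≡⟨ lookup∘tabulate (triangle σ) i ⟨
        lookup t i                                                        ≡⟨ cuts-correct t i ⟩
        (lookup s (inject₁ i) xor lookup s (suc i)) xor lookup e i
          ≡⟨ cong ((lookup s (inject₁ i) xor lookup s (suc i)) xor_) (trans (sym (subfan-rim s e i)) d) ⟩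
        (lookup s (inject₁ i) xor lookup s (suc i)) xor false             ≡⟨ xor-identityʳ _ ⟩
        lookup s (inject₁ i) xor lookup s (suc i)                         ∎))
    where
    rimCase : ∀ a b r c d → (a xor b) xor r ≡ c xor d → r ≡ (a xor c) xor (b xor d)
    rimCase a b r c d eq = begin
      r                               ≡⟨ xor.solve 3 (λ a b r → r := (a :+ b) :+ ((a :+ b) :+ r)) refl a b r ⟩
      (a xor b) xor ((a xor b) xor r) ≡⟨ cong ((a xor b) xor_) eq ⟩
      (a xor b) xor (c xor d)         ≡⟨ xor.solve 4 (λ a b c d → (a :+ b) :+ (c :+ d) := (a :+ c) :+ (b :+ d)) refl a b c d ⟩
      (a xor c) xor (b xor d)         ∎

packing-isFrustrationIndex : (σ : Signature (fan (suc m))) → IsFrustrationIndex σ (packing (triangles σ))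
packing-isFrustrationIndex σ = packing-deletion σ , packing-≤-deletion σ

-- Signatures of maximum frustration.

-- The representative with all spokes positive: each triangle then has the sign of its rim edge, so
-- every vector is realised.
signatureOf : Vec Bool m → Signature (fan (suc m))
signatureOf t .sgn {suc i} {suc j} _ = toSign (alongRim t i j)
signatureOf t .sgn {zero}  {_}     _ = pos
signatureOf t .sgn {suc _} {zero}  _ = pos
signatureOf t .sgn-sym {zero}  {zero}  _ _ = refl
signatureOf t .sgn-sym {zero}  {suc _} _ _ = refl
signatureOf t .sgn-sym {suc _} {zero}  _ _ = refl
signatureOf t .sgn-sym {suc i} {suc j} _ _ = cong toSign (alongRim-sym t i j)

triangles-signatureOf : (t : Vec Bool m) → triangles (signatureOf t) ≡ t
triangles-signatureOf t = trans
  (tabulate-cong λ i → trans (isNeg-toSign _) (alongRim-edge t i))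
  (tabulate∘lookup t)

isFrustrationIndex-unique : ∀ {G : Graph n} (σ : Signature G) {k l} →
  IsFrustrationIndex σ k → IsFrustrationIndex σ l → k ≡ l
isFrustrationIndex-unique σ (dₖ , minₖ) (dₗ , minₗ) = ≤-antisym (minₖ _ dₗ) (minₗ _ dₖ)

-- Making all triangles negative attains the upper bound of `packing-≤`, so no maximiser stays below
-- it.
maximises⇒packing : (σ : Signature (fan (suc m))) → MaximisesFrustration σ → packing (triangles σ) ≡ ⌈ m /2⌉
maximises⇒packing {m} σ (k , l≡k , _ , max) = ≤-antisym (packing-≤ (triangles σ)) (begin
  ⌈ m /2⌉                      ≡⟨ packing-replicate m ⟨
  packing all-negative         ≡⟨ cong packing (triangles-signatureOf all-negative) ⟨
  packing (triangles τ)        ≤⟨ max _ (τ , packing-isFrustrationIndex τ) ⟩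
  k                            ≡⟨ isFrustrationIndex-unique σ l≡k (packing-isFrustrationIndex σ) ⟩
  packing (triangles σ)        ∎)
  where
  open ≤-Reasoning
  all-negative = replicate m true
  τ = signatureOf all-negative

packing⇒maximises : (σ : Signature (fan (suc m))) → packing (triangles σ) ≡ ⌈ m /2⌉ → MaximisesFrustration σ
packing⇒maximises {m} σ eq = packing (triangles σ) , l , (σ , l) , λ k (τ , l′) → begin
  k                     ≡⟨ isFrustrationIndex-unique τ l′ (packing-isFrustrationIndex τ) ⟩
  packing (triangles τ) ≤⟨ packing-≤ (triangles τ) ⟩
  ⌈ m /2⌉               ≡⟨ eq ⟨
  packing (triangles σ) ∎
  where
  open ≤-Reasoning
  l = packing-isFrustrationIndex σ

-- Switching classes as triangle vectors.

-- Each vertex of a triangle lies on two of its edges, so its switching cancels.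
∼⇒triangles≡ : {σ τ : Signature (fan (suc m))} → σ ∼ τ → triangles σ ≡ triangles τ
∼⇒triangles≡ {m} {σ} {τ} (X , eq) = tabulate-cong λ i → sym (begin
  triangle τ i
    ≡⟨ cong₂ _xor_ (cong₂ _xor_ (switched zero (suc (inject₁ i)) tt) (switched zero (suc (suc i)) tt))
                   (switched (suc (inject₁ i)) (suc (suc i)) (rimEdge i)) ⟩
  (((x zero xor x (suc (inject₁ i))) xor spoke σ (inject₁ i)) xor ((x zero xor x (suc (suc i))) xor spoke σ (suc i)))
    xor ((x (suc (inject₁ i)) xor x (suc (suc i))) xor rim σ i)
    ≡⟨ xor.solve 6 (λ h x y a b r → (((h :+ x) :+ a) :+ ((h :+ y) :+ b)) :+ ((x :+ y) :+ r) := (a :+ b) :+ r) refl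
         (x zero) (x (suc (inject₁ i))) (x (suc (suc i))) (spoke σ (inject₁ i)) (spoke σ (suc i)) (rim σ i) ⟩
  triangle σ i ∎)
  where
  open ≡-Reasoning
  x = lookup X
  switched : ∀ u v (p : fan (suc m) ⊢ u ~ v) → negative τ u v p ≡ (x u xor x v) xor negative σ u v p
  switched u v p = trans (cong isNeg (sym (eq {u} {v} p))) (isNeg-negateIf (x u xor x v) (sgn σ {u} {v} p))

-- Switching can make the spokes agree; equal triangle signs then force the rim edges to agree.
triangles≡⇒∼ : {σ τ : Signature (fan (suc m))} → triangles σ ≡ triangles τ → σ ∼ τ
triangles≡⇒∼ {m} {σ} {τ} eq = X , λ {u} {v} p →
  isNeg-injective (trans (isNeg-negateIf (x u xor x v) (sgn σ {u} {v} p)) (switched u v p))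
  where
  open ≡-Reasoning
  -- The hub stays fixed, and a rim vertex is switched exactly when its spoke differs in the two
  -- signatures.
  X = false ∷ Vec.tabulate (λ i → spoke σ i xor spoke τ i)
  x = lookup X
  x-suc : ∀ i → x (suc i) ≡ spoke σ i xor spoke τ i
  x-suc = lookup∘tabulate _
  triangle≡ : ∀ i → triangle σ i ≡ triangle τ i
  triangle≡ i = trans (sym (lookup∘tabulate (triangle σ) i))
                  (trans (cong (λ t → lookup t i) eq) (lookup∘tabulate (triangle τ) i))
  switched : ∀ u v (p : fan (suc m) ⊢ u ~ v) → (x u xor x v) xor negative σ u v p ≡ negative τ u v p
  switched = fan-elim (λ u v p → (x u xor x v) xor negative σ u v p ≡ negative τ u v p)
    (λ u v p q h → trans (cong₂ _xor_ (xor-comm (x v) (x u)) (negative-sym σ v u q p))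
                         (trans h (negative-sym τ u v p q)))
    (λ i → trans (cong (_xor spoke σ i) (x-suc i))
                 (xor.solve 2 (λ a b → (a :+ b) :+ a := b) refl (spoke σ i) (spoke τ i)))
    (λ i → trans (cong (_xor rim σ i) (cong₂ _xor_ (x-suc (inject₁ i)) (x-suc (suc i))))
                 (rimCase (spoke σ (inject₁ i)) (spoke σ (suc i)) (spoke τ (inject₁ i)) (spoke τ (suc i)) _ _ (triangle≡ i)))
    where
    rimCase : ∀ a b c d r q → (a xor b) xor r ≡ (c xor d) xor q → ((a xor c) xor (b xor d)) xor r ≡ q
    rimCase a b c d r q h = begin
      ((a xor c) xor (b xor d)) xor r
        ≡⟨ xor.solve 5 (λ a b c d r → ((a :+ c) :+ (b :+ d)) :+ r := (c :+ d) :+ ((a :+ b) :+ r)) refl a b c d r ⟩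
      (c xor d) xor ((a xor b) xor r) ≡⟨ cong ((c xor d) xor_) h ⟩
      (c xor d) xor ((c xor d) xor q) ≡⟨ xor.solve 3 (λ c d q → (c :+ d) :+ ((c :+ d) :+ q) := q) refl c d q ⟩
      q ∎

-- Counting the maximising classes.

-- A class goes to the position of its triangle vector among those of maximal packing. Since
-- `T (p t)` is a proposition, the position is independent of the proof of maximality carried by the
-- signature; `unindex` recovers the vector and gives injectivity.
maximisingSwitchingClasses-fan : ∀ m →
  HasCardinality (maximisingSwitchingClasses (fan (suc m))) (withPacking m ⌈ m /2⌉)
maximisingSwitchingClasses-fan m = record
  { to        = λ (σ , max) → index p (triangles σ) (optimal σ max)
  ; cong      = λ {(σ , max)} {(τ , max′)} σ∼τ →
      index-cong (∼⇒triangles≡ {σ = σ} {τ} σ∼τ) (optimal σ max) (optimal τ max′)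
  ; bijective =
      (λ {(σ , max)} {(τ , max′)} eq → triangles≡⇒∼ {σ = σ} {τ}
        (trans (sym (unindex-index p _ (optimal σ max)))
               (trans (cong (unindex p) eq) (unindex-index p _ (optimal τ max′)))))
    , λ i → let t , pt , eq = index-surjective p i
                σ           = signatureOf t
                tσ≡t        = triangles-signatureOf t
            in (σ , packing⇒maximises σ (trans (cong packing tσ≡t) (≡ᵇ⇒≡ _ _ pt)))
             , λ {(τ , max)} τ∼σ →
                 trans (index-cong (trans (∼⇒triangles≡ {σ = τ} {σ} τ∼σ) tσ≡t) (optimal τ max) pt) eq
  }
  where
  p : Vec Bool m → Bool
  p t = packing t ≡ᵇ ⌈ m /2⌉
  optimal : ∀ σ → MaximisesFrustration σ → T (p (triangles σ))
  optimal σ max = ≡⇒≡ᵇ _ _ (maximises⇒packing σ max)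
  index-cong : ∀ {t t′} → t ≡ t′ → (q : T (p t)) (q′ : T (p t′)) → index p t q ≡ index p t′ q′
  index-cong {t} refl q q′ = cong (index p t) (T-irrelevant q q′)

-- The closed formulas.

-- Written as `j * 2` because `suc j * 2` computes to `suc (suc (j * 2))`, in step with the two-step
-- recursion.
data Parity : ℕ → Set where
  even : ∀ j → Parity (j * 2)
  odd  : ∀ j → Parity (suc (j * 2))

parity : ∀ m → Parity m
parity zero = even 0
parity (suc m) with parity m
... | even j = odd j
... | odd j  = even (suc j)

corollary21 : (n : ℕ) → n ≥ 1 →
    ∃[ N ] HasCardinality (maximisingSwitchingClasses (fan n)) N
    × (n % 2 ≡ 0 → N ≡ 2 ^ (n / 2 ∸ 1))
    × (n % 2 ≡ 1 → 2 * N ≡ ((n + 3) / 2) * 2 ^ ((n ∸ 1) / 2))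
corollary21 (suc m) _ = withPacking m ⌈ m /2⌉ , maximisingSwitchingClasses-fan m , formula (parity m)
  where
  formula : ∀ {m} → Parity m → let n = suc m; N = withPacking m ⌈ m /2⌉ in
    (n % 2 ≡ 0 → N ≡ 2 ^ (n / 2 ∸ 1)) × (n % 2 ≡ 1 → 2 * N ≡ ((n + 3) / 2) * 2 ^ ((n ∸ 1) / 2))
  -- There is one triangle fewer than path vertices: an even number of triangles means that `n` is
  -- odd, which refutes the premise of the first formula.
  formula (even j) = (λ eq → contradiction (trans (sym ([m+kn]%n≡m%n 1 j 2)) eq) λ ()) , λ _ → begin
    2 * withPacking (j * 2) ⌈ j * 2 /2⌉               ≡⟨ cong (λ k → 2 * withPacking (j * 2) k) (⌈j*2/2⌉ j) ⟩
    2 * withPacking (j * 2) j                         ≡⟨ withPacking-even j ⟩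
    (2 + j) * 2 ^ j                                   ≡⟨ cong₂ (λ a b → a * 2 ^ b) (m*n/n≡m (2 + j) 2) (m*n/n≡m j 2) ⟨
    ((2 + j) * 2) / 2 * 2 ^ (j * 2 / 2)               ≡⟨ cong (λ a → a / 2 * 2 ^ (j * 2 / 2)) (shift j) ⟩
    (suc (j * 2) + 3) / 2 * 2 ^ (j * 2 / 2)           ∎
    where
    open ≡-Reasoning
    shift : ∀ j → (2 + j) * 2 ≡ suc (j * 2) + 3
    shift = solve-∀
  formula (odd j) = (λ _ → begin
    withPacking (suc (j * 2)) ⌈ suc (j * 2) /2⌉       ≡⟨ cong (withPacking (suc (j * 2))) (⌈1+j*2/2⌉ j) ⟩
    withPacking (suc (j * 2)) (suc j)                 ≡⟨ withPacking-odd j ⟩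
    2 ^ j                                             ≡⟨ cong (λ k → 2 ^ (k ∸ 1)) (m*n/n≡m (suc j) 2) ⟨
    2 ^ (suc j * 2 / 2 ∸ 1)                           ∎)
    , λ eq → contradiction (trans (sym (m*n%n≡0 (suc j) 2)) eq) λ ()
    where open ≡-Reasoning
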